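{- Let $p\ge 2$ be an integer and let $D$ be an infinite $p$-digit table with domain $\mathbb{Z}_p$ that has the block property. Then there is a unique (closed) $p$-fibred function $F_D$ in canonical form whose $F_D$-digit table is equal to $D$. In particular, $F_D$ is a $p$-adic system.
   Context: $p\ge2$ is an integer, not necessarily prime. $\mathbb{Z}_p=\varprojlim \mathbb{Z}/p^k\mathbb{Z}$; every $a\in\mathbb{Z}_p$ is uniquely $a=\sum_{i\ge0}a_ip^i$ with $a_i\in\{0,\dots,p-1\}$, and $a\,\%\,p^k:=\sum_{i<k}a_ip^i\in\{0,\dots,p^k-1\}$. Infinite $p$-digit table with domain $A\subseteq\mathbb{Z}_p$: a family $D=(D[n])_{n\in A}$ of infinite sequences $D[n]=(D[n][0],D[n][1],\dots)$ with entries in $\{0,\dots,p-1\}$ such that $D[n][0]=n\,\%\,p$ for all $n\in A$. It has the block property if for all integers $k\ge0$ and all $m,n\in A$: $m\equiv n \pmod{p^k}$ if and only if the first $k$ entries of $D[m]$ and $D[n]$ coincide. $p$-fibred function with domain $A\subseteq\mathbb{Z}_p$: a $p$-tuple $F=(F[0],\dots,F[p-1])$ of functions $F[r]:A\to\mathbb{Z}_p$. It is also regarded as a function $F:A\to\mathbb{Z}_p$ by $F(n)=\dfrac{F[n\%p](n)-(F[n\%p](n)\,\%\,p)}{p}$. $F$ is closed if $F(A)\subseteq A$. For closed $F$ the $F$-digit table is the family, indexed by $n\in A$, of the sequences $(F^k(n)\,\%\,p)_{k\ge0}$; it is an infinite $p$-digit table with domain $A$. A $p$-adic system is a $p$-fibred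 function with domain $\mathbb{Z}_p$ whose $F$-digit table has the block property. $F$ is in canonical form if for all $r\in\{0,\dots,p-1\}$ and all $n$ in its domain: $F[r](n)\in p\mathbb{Z}_p$ if $n\equiv r\pmod p$, and $F[r](n)=0$ if $n\not\equiv r\pmod p$. -}

module Defs where

open import Algebra.Bundles using (CommutativeRing)
import Algebra.Properties.Semiring.Divisibility as Divisibility
open import Data.Fin.Base using (Fin; toℕ; fromℕ<)
open import Data.Fin.Properties using (toℕ-injective; toℕ-fromℕ<)
open import Data.Integer.Base as Int using (ℤ; +_; 0ℤ; 1ℤ)
open import Data.Integer.DivMod using (_/ℕ_; _%ℕ_; n%ℕd<d; a≡a%ℕn+[a/ℕn]*n)
open import Data.Integer.Divisibility.Signed
  using (divides; ∣⇒∣ᵤ; ∣-trans; *-cancelʳ-∣)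
  renaming (_∣_ to _∣ᶻ_)
import Data.Integer.Properties as IntP
open import Data.Integer.Tactic.RingSolver using (solve-∀)
open import Data.Nat.Base as ℕ using (ℕ; zero; suc; _^_; _<_; NonZero; NonTrivial)
import Data.Nat.Divisibility as ℕ
open import Data.Nat.GeneralisedArithmetic using (iterate)
import Data.Nat.Properties as ℕ
open import Data.Product.Base using (Σ; _×_; _,_; proj₁; proj₂)
open import Data.Unit.Base using (⊤; tt)
open import Function.Bundles using (Func; _⇔_)
open import Level using (0ℓ)
open import Relation.Binary.Bundles using (Setoid)
import Relation.Binary.Construct.On as On
open import Relation.Binary.Definitions using (_Respects_)
open import Relation.Binary.PropositionalEquality
  using (_≡_; refl; sym; trans; cong; cong₂; subst; _→-setoid_; module ≡-Reasoning)
open import Relation.Nullary.Negation using (¬_)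
open import Relation.Unary using (Pred)

-- Congruences between integers, used on the components of elements of ℤₚ.
-- The proofs occur inside elements of ℤₚ, so without `abstract` conversion
-- checking would unfold them.
module Mod where
  open Int using (_+_; _*_; _-_; -_)

  abstract

    ≡⇒∣ : ∀ {d a b} → a ≡ b → d ∣ᶻ a - b
    ≡⇒∣ {d} {a} refl = divides 0ℤ (lem a d)
      where lem : ∀ a d → a - a ≡ 0ℤ * d
            lem = solve-∀

    ∣-sym : ∀ {d a b} → d ∣ᶻ a - b → d ∣ᶻ b - a
    ∣-sym {d} {a} {b} (divides t e) =
      divides (- t) (trans (flip a b) (trans (cong -_ e) (neg t d)))
      where flip : ∀ a b → b - a ≡ - (a - b)
            flip = solve-∀
            neg : ∀ t d → - (t * d) ≡ (- t) * d
            neg = solve-∀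

    ∣-transᵈ : ∀ {d a b c} → d ∣ᶻ a - b → d ∣ᶻ b - c → d ∣ᶻ a - c
    ∣-transᵈ {d} {a} {b} {c} (divides t e) (divides u f) =
      divides (t + u) (trans (split a b c) (trans (cong₂ _+_ e f) (dist t u d)))
      where split : ∀ a b c → a - c ≡ (a - b) + (b - c)
            split = solve-∀
            dist : ∀ t u d → t * d + u * d ≡ (t + u) * d
            dist = solve-∀

    +-cong : ∀ {d a b a′ b′} → d ∣ᶻ a - a′ → d ∣ᶻ b - b′ → d ∣ᶻ (a + b) - (a′ + b′)
    +-cong {d} {a} {b} {a′} {b′} (divides t e) (divides u f) =
      divides (t + u) (trans (split a b a′ b′) (trans (cong₂ _+_ e f) (dist t u d)))
      where split : ∀ a b a′ b′ → (a + b) - (a′ + b′) ≡ (a - a′) + (b - b′)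
            split = solve-∀
            dist : ∀ t u d → t * d + u * d ≡ (t + u) * d
            dist = solve-∀

    *-cong : ∀ {d a b a′ b′} → d ∣ᶻ a - a′ → d ∣ᶻ b - b′ → d ∣ᶻ (a * b) - (a′ * b′)
    *-cong {d} {a} {b} {a′} {b′} (divides t e) (divides u f) =
      divides (t * b + a′ * u)
        (trans (split a b a′ b′)
          (trans (cong₂ (λ v w → v * b + a′ * w) e f) (dist t u d b a′)))
      where split : ∀ a b a′ b′ → a * b - a′ * b′ ≡ (a - a′) * b + a′ * (b - b′)
            split = solve-∀
            dist : ∀ t u d b a′ → (t * d) * b + a′ * (u * d) ≡ (t * b + a′ * u) * d
            dist = solve-∀

    neg-cong : ∀ {d a b} → d ∣ᶻ a - b → d ∣ᶻ (- a) - (- b)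
    neg-cong {d} {a} {b} h = subst (d ∣ᶻ_) (flip a b) (∣-sym {d} {a} {b} h)
      where flip : ∀ a b → b - a ≡ (- a) - (- b)
            flip = solve-∀

    ∣-diff : ∀ {d a b} → d ∣ᶻ b → d ∣ᶻ a - b → d ∣ᶻ a
    ∣-diff {d} {a} {b} (divides t e) (divides u f) =
      divides (u + t) (trans (split a b) (trans (cong₂ _+_ f e) (dist u t d)))
      where split : ∀ a b → a ≡ (a - b) + b
            split = solve-∀
            dist : ∀ t u d → t * d + u * d ≡ (t + u) * d
            dist = solve-∀

    rem-diff : ∀ a b d .{{_ : NonZero d}} →
               a - b ≡ (+ (a %ℕ d) - + (b %ℕ d)) + (a /ℕ d - b /ℕ d) * + d
    rem-diff a b d =
      trans (cong₂ _-_ (a≡a%ℕn+[a/ℕn]*n a d) (a≡a%ℕn+[a/ℕn]*n b d))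
            (lem (+ (a %ℕ d)) (+ (b %ℕ d)) (a /ℕ d) (b /ℕ d) (+ d))
      where lem : ∀ r s q q′ d → (r + q * d) - (s + q′ * d) ≡ (r - s) + (q - q′) * d
            lem = solve-∀

    rem-cong : ∀ a b d .{{_ : NonZero d}} → + d ∣ᶻ a - b → a %ℕ d ≡ b %ℕ d
    rem-cong a b d (divides t e) = IntP.+-injective (IntP.i-j≡0⇒i≡j _ _ (IntP.∣i∣≡0⇒i≡0 zero-abs))
      where
      d∣r-s : + d ∣ᶻ + (a %ℕ d) - + (b %ℕ d)
      d∣r-s = divides (t - (a /ℕ d - b /ℕ d))
        (trans (move _ _ _ (trans (sym (rem-diff a b d)) e)) (dist t _ (+ d)))
        where move : ∀ x y z → x + y ≡ z → x ≡ z - y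
              move x y z refl = lem x y
                where lem : ∀ x y → x ≡ (x + y) - y
                      lem = solve-∀
              dist : ∀ t q d → t * d - q * d ≡ (t - q) * d
              dist = solve-∀
      small : Int.∣ + (a %ℕ d) - + (b %ℕ d) ∣ < d
      small = ℕ.≤-<-trans
        (subst (ℕ._≤ (a %ℕ d) ℕ.⊔ (b %ℕ d)) (cong Int.∣_∣ (sym (IntP.m-n≡m⊖n (a %ℕ d) (b %ℕ d)))) (IntP.∣m⊝n∣≤m⊔n (a %ℕ d) (b %ℕ d)))
        (ℕ.⊔-lub (n%ℕd<d a d) (n%ℕd<d b d))
      zero-abs : Int.∣ + (a %ℕ d) - + (b %ℕ d) ∣ ≡ 0
      zero-abs = absurd-or-zero Int.∣ + (a %ℕ d) - + (b %ℕ d) ∣ small (∣⇒∣ᵤ d∣r-s)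
        where absurd-or-zero : ∀ m → m < d → d ℕ.∣ m → m ≡ 0
              absurd-or-zero zero    _   _   = refl
              absurd-or-zero (suc m) m<d d∣m with ℕ.<⇒≱ m<d (ℕ.∣⇒≤ d∣m)
              ... | ()

    /-cong : ∀ a b d e .{{_ : NonZero d}} →
             + (d ℕ.* e) ∣ᶻ a - b → + e ∣ᶻ (a /ℕ d) - (b /ℕ d)
    /-cong a b d e h@(divides t eq) = *-cancelʳ-∣ (+ d) (divides t (begin
      (a /ℕ d - b /ℕ d) * + d
        ≡⟨ sym (trans (cong (_+ (a /ℕ d - b /ℕ d) * + d) r-s≡0) (IntP.+-identityˡ _)) ⟩
      (+ (a %ℕ d) - + (b %ℕ d)) + (a /ℕ d - b /ℕ d) * + d
        ≡⟨ sym (rem-diff a b d) ⟩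
      a - b
        ≡⟨ eq ⟩
      t * + (d ℕ.* e)
        ≡⟨ cong (t *_) (trans (IntP.pos-* d e) (IntP.*-comm (+ d) (+ e))) ⟩
      t * (+ e * + d)
        ∎))
      where
      open ≡-Reasoning
      instance
        +d≢0 : Int.NonZero (+ d)
        +d≢0 = Int.≢-nonZero λ +d≡0 → ℕ.≢-nonZero⁻¹ d (IntP.+-injective +d≡0)
      r-s≡0 : + (a %ℕ d) - + (b %ℕ d) ≡ 0ℤ
      r-s≡0 = IntP.i≡j⇒i-j≡0 (cong +_ (rem-cong a b d
        (∣-trans (divides (+ e) (trans (IntP.pos-* d e) (IntP.*-comm (+ d) (+ e)))) h)))

module PAdic (p : ℕ) .{{_ : NonTrivial p}} where

  private
    instance
      p≢0 : NonZero p
      p≢0 = ℕ.nonTrivial⇒nonZero p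

  -- The inverse limit of the rings ℤ/pᵏℤ. The k-th component is an integer
  -- representing a class modulo pᵏ, so equality of elements is _≈_ below.

  record ℤₚ : Set where
    no-eta-equality
    field
      res      : ℕ → ℤ
      coherent : ∀ k → + (p ^ k) ∣ᶻ res (suc k) Int.- res k

  open ℤₚ public

  infix 4 _≈_

  record _≈_ (x y : ℤₚ) : Set where
    constructor mk≈
    field
      at : ∀ k → + (p ^ k) ∣ᶻ res x k Int.- res y k

  open _≈_ public

  ι : ℤ → ℤₚ
  ι a = record { res = λ _ → a ; coherent = λ k → Mod.≡⇒∣ {b = a} refl }

  private
    _+ₚ_ _*ₚ_ : ℤₚ → ℤₚ → ℤₚ
    x +ₚ y = record
      { res      = λ k → res x k Int.+ res y k
      ; coherent = λ k → Mod.+-cong {a = res x (suc k)} {b = res y (suc k)}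
                                    (coherent x k) (coherent y k)
      }
    x *ₚ y = record
      { res      = λ k → res x k Int.* res y k
      ; coherent = λ k → Mod.*-cong {a = res x (suc k)} {b = res y (suc k)}
                                    (coherent x k) (coherent y k)
      }

    -ₚ_ : ℤₚ → ℤₚ
    -ₚ x = record
      { res      = λ k → Int.- res x k
      ; coherent = λ k → Mod.neg-cong {a = res x (suc k)} (coherent x k)
      }

    pointwise : ∀ {x y} → (∀ k → res x k ≡ res y k) → x ≈ y
    pointwise e = mk≈ λ k → Mod.≡⇒∣ (e k)

  ℤₚ-ring : CommutativeRing 0ℓ 0ℓ
  ℤₚ-ring = record
    { Carrier = ℤₚ
    ; _≈_     = _≈_
    ; _+_     = _+ₚ_
    ; _*_     = _*ₚ_
    ; -_      = -ₚ_
    ; 0#      = ι 0ℤ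
    ; 1#      = ι 1ℤ
    ; isCommutativeRing = record
      { isRing = record
        { +-isAbelianGroup = record
          { isGroup = record
            { isMonoid = record
              { isSemigroup = record
                { isMagma = record
                  { isEquivalence = record
                    { refl  = pointwise λ k → refl
                    ; sym   = λ {x} {y} e → mk≈ λ k → Mod.∣-sym {a = res x k} (at e k)
                    ; trans = λ {x} {y} {z} e f → mk≈ λ k →
                        Mod.∣-transᵈ {a = res x k} {b = res y k} (at e k) (at f k)
                    }
                  ; ∙-cong = λ {x} {y} {u} {v} e f → mk≈ λ k →
                      Mod.+-cong {a = res x k} {b = res u k} (at e k) (at f k)
                  }
                ; assoc = λ x y z → pointwise λ k → IntP.+-assoc (res x k) (res y k) (res z k)
                }
              ; identity = (λ x → pointwise λ k → IntP.+-identityˡ (res x k))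
                         , (λ x → pointwise λ k → IntP.+-identityʳ (res x k))
              }
            ; inverse = (λ x → pointwise λ k → IntP.+-inverseˡ (res x k))
                      , (λ x → pointwise λ k → IntP.+-inverseʳ (res x k))
            ; ⁻¹-cong = λ {x} {y} e → mk≈ λ k → Mod.neg-cong {a = res x k} (at e k)
            }
          ; comm = λ x y → pointwise λ k → IntP.+-comm (res x k) (res y k)
          }
        ; *-cong = λ {x} {y} {u} {v} e f → mk≈ λ k →
            Mod.*-cong {a = res x k} {b = res u k} (at e k) (at f k)
        ; *-assoc = λ x y z → pointwise λ k → IntP.*-assoc (res x k) (res y k) (res z k)
        ; *-identity = (λ x → pointwise λ k → IntP.*-identityˡ (res x k))
                     , (λ x → pointwise λ k → IntP.*-identityʳ (res x k))
        ; distrib =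
            (λ x y z → pointwise λ k → IntP.*-distribˡ-+ (res x k) (res y k) (res z k))
          , (λ x y z → pointwise λ k → IntP.*-distribʳ-+ (res x k) (res y k) (res z k))
        }
      ; *-comm = λ x y → pointwise λ k → IntP.*-comm (res x k) (res y k)
      }
    }

  open CommutativeRing ℤₚ-ring public
    using (0#; 1#; _+_; _*_; -_; _-_)
    renaming (setoid to ℤₚ-setoid; refl to ≈-refl; sym to ≈-sym; trans to ≈-trans)
  open CommutativeRing ℤₚ-ring using (semiring)
  module Div = Divisibility semiring
  open Div public using (_∣_)

  infix 4 _≋_[mod_]

  _≋_[mod_] : ℤₚ → ℤₚ → ℕ → Set
  x ≋ y [mod d ] = ι (+ d) ∣ (x - y)

  private
    %p-< : ∀ x → res x 1 %ℕ p < p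
    %p-< x = n%ℕd<d (res x 1) p

    p∣p^1 : ∀ {a} → + (p ^ 1) ∣ᶻ a → + p ∣ᶻ a
    p∣p^1 {a} = subst (λ q → + q ∣ᶻ a) (ℕ.*-identityʳ p)

  infixl 7 _%p _/p

  -- The digit x₀ of x = Σ xᵢpⁱ, read off from the class of x in ℤ/pℤ;
  -- see x≋x%p.
  _%p : ℤₚ → Fin p
  x %p = fromℕ< (%p-< x)

  %p-cong : ∀ {x y} → x ≈ y → x %p ≡ y %p
  %p-cong {x} {y} e = toℕ-injective (trans (toℕ-fromℕ< (%p-< x))
    (trans (Mod.rem-cong (res x 1) (res y 1) p (p∣p^1 (at e 1)))
           (sym (toℕ-fromℕ< (%p-< y)))))

  ⌊_⌋ : Fin p → ℤₚ
  ⌊ r ⌋ = ι (+ toℕ r)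

  -- Division by p. It is exact on pℤₚ (see p∣x⇒p*[x/p]≈x) and is only
  -- ever applied there; elsewhere it discards the digit x₀.
  _/p : ℤₚ → ℤₚ
  x /p = record
    { res      = λ k → res x (suc k) /ℕ p
    ; coherent = λ k → Mod./-cong (res x (suc (suc k))) (res x (suc k)) p (p ^ k)
                                  (coherent x (suc k))
    }

  /p-cong : ∀ {x y} → x ≈ y → x /p ≈ y /p
  /p-cong {x} {y} e = mk≈ λ k →
    Mod./-cong (res x (suc k)) (res y (suc k)) p (p ^ k) (at e (suc k))

  tail-cong : ∀ {x y} → x ≈ y → (x - ⌊ x %p ⌋) /p ≈ (y - ⌊ y %p ⌋) /p
  tail-cong {x} {y} e = /p-cong {x - ⌊ x %p ⌋} {y - ⌊ y %p ⌋}
    (sub-cong {x} {y} {⌊ x %p ⌋} {⌊ y %p ⌋} e (⌊⌋-cong {x %p} {y %p} (%p-cong e)))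
    where
    sub-cong : ∀ {x y u v} → x ≈ y → u ≈ v → x - u ≈ y - v
    sub-cong {x} {y} {u} {v} e f = mk≈ λ k →
      Mod.+-cong {a = res x k} {b = Int.- res u k} (at e k)
                 (Mod.neg-cong {a = res u k} (at f k))
    ⌊⌋-cong : ∀ {r s} → r ≡ s → ⌊ r ⌋ ≈ ⌊ s ⌋
    ⌊⌋-cong {r} refl = mk≈ λ k → Mod.≡⇒∣ {a = + toℕ r} refl

  p∣x⇒p*[x/p]≈x : ∀ x → ι (+ p) ∣ x → ι (+ p) * (x /p) ≈ x
  p∣x⇒p*[x/p]≈x x (q Div., q*p≈x) = mk≈ λ k →
    subst (λ a → + (p ^ k) ∣ᶻ a Int.- res x k) (sym (exact k)) (coherent x k)
    where
    p∣ : ∀ k → + p ∣ᶻ res x (suc k)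
    p∣ k = Mod.∣-diff {b = res q (suc k) Int.* + p} (divides (res q (suc k)) refl)
      (Mod.∣-sym {a = res q (suc k) Int.* + p}
        (∣-trans (divides (+ (p ^ k)) (trans (IntP.pos-* p (p ^ k)) (IntP.*-comm (+ p) _)))
                 (at q*p≈x (suc k))))
    no-rem : ∀ k → res x (suc k) %ℕ p ≡ 0
    no-rem k = trans
      (Mod.rem-cong (res x (suc k)) 0ℤ p
        (subst (+ p ∣ᶻ_) (sym (IntP.+-identityʳ _)) (p∣ k)))
      (0%ℕ p)
      where 0%ℕ : ∀ d .{{_ : NonZero d}} → 0ℤ %ℕ d ≡ 0
            0%ℕ (suc d) = refl
    exact : ∀ k → + p Int.* (res x (suc k) /ℕ p) ≡ res x (suc k)
    exact k = trans (IntP.*-comm (+ p) _) (sym (trans (a≡a%ℕn+[a/ℕn]*n (res x (suc k)) p)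
      (trans (cong (λ r → + r Int.+ (res x (suc k) /ℕ p) Int.* + p) (no-rem k))
             (IntP.+-identityˡ _))))

  x≋x%p : ∀ x → x ≋ ⌊ x %p ⌋ [mod p ]
  x≋x%p x = (x /p) Div., mk≈ λ k →
    subst (+ (p ^ k) ∣ᶻ_) (sym (lem k)) (coherent x k)
    where
    r≡ : ∀ k → res x (suc k) %ℕ p ≡ toℕ (x %p)
    r≡ zero    = sym (toℕ-fromℕ< (%p-< x))
    r≡ (suc k) = trans
      (Mod.rem-cong (res x (suc (suc k))) (res x (suc k)) p
        (∣-trans (divides (+ (p ^ k)) (trans (IntP.pos-* p (p ^ k)) (IntP.*-comm (+ p) _)))
                 (coherent x (suc k))))
      (r≡ k)
    lem : ∀ k → (res x (suc k) /ℕ p) Int.* + p Int.- (res x k Int.- + toℕ (x %p))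
              ≡ res x (suc k) Int.- res x k
    lem k = trans (alg ((res x (suc k) /ℕ p) Int.* + p) (res x k) (+ toℕ (x %p)))
      (cong (Int._- res x k)
        (trans (cong (λ r → + r Int.+ (res x (suc k) /ℕ p) Int.* + p) (sym (r≡ k)))
               (sym (a≡a%ℕn+[a/ℕn]*n (res x (suc k)) p))))
      where alg : ∀ q x r → q Int.- (x Int.- r) ≡ (r Int.+ q) Int.- x
            alg = solve-∀

  record Subset : Set₁ where
    field
      Mem  : Pred ℤₚ 0ℓ
      resp : Mem Respects _≈_

  open Subset public

  full : Subset
  full = record { Mem = λ _ → ⊤ ; resp = λ _ _ → tt }

  Elem : Subset → Set
  Elem A = Σ ℤₚ (Mem A)

  -- Equality of elements of A ignores the membership proofs.
  elemSetoid : Subset → Setoid 0ℓ 0ℓ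
  elemSetoid A = On.setoid {B = Elem A} ℤₚ-setoid proj₁

  record DigitTable (A : Subset) : Set where
    field
      table : Func (elemSetoid A) (ℕ →-setoid Fin p)

    row : Elem A → ℕ → Fin p
    row = Func.to table

    field
      head : ∀ n → row n 0 ≡ proj₁ n %p

  open DigitTable public using (row)

  infix 4 _≈ᵀ_

  _≈ᵀ_ : ∀ {A} → DigitTable A → DigitTable A → Set
  D ≈ᵀ E = ∀ n k → row D n k ≡ row E n k

  BlockProperty : ∀ {A} → DigitTable A → Set
  BlockProperty {A} D = ∀ (k : ℕ) (m n : Elem A) →
    (proj₁ m ≋ proj₁ n [mod p ^ k ]) ⇔ (∀ i → i < k → row D m i ≡ row D n i)

  FibredFunction : Subset → Set
  FibredFunction A = Fin p → Func (elemSetoid A) ℤₚ-setoid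

  module _ {A : Subset} where

    infix 9 _[_]
    infix 4 _≈ᶠ_

    _[_] : FibredFunction A → Fin p → Elem A → ℤₚ
    F [ r ] = Func.to (F r)

    _≈ᶠ_ : FibredFunction A → FibredFunction A → Set
    F ≈ᶠ G = ∀ r n → (F [ r ]) n ≈ (G [ r ]) n

    fun : FibredFunction A → Elem A → ℤₚ
    fun F n = (y - ⌊ y %p ⌋) /p
      where y = (F [ proj₁ n %p ]) n

    Closed : FibredFunction A → Set
    Closed F = ∀ n → Mem A (fun F n)

    step : (F : FibredFunction A) → Closed F → Elem A → Elem A
    step F closed n = fun F n , closed n

    CanonicalForm : FibredFunction A → Set
    CanonicalForm F = ∀ r n →
      (proj₁ n ≋ ⌊ r ⌋ [mod p ] → ι (+ p) ∣ (F [ r ]) n) ×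
      (¬ (proj₁ n ≋ ⌊ r ⌋ [mod p ]) → (F [ r ]) n ≈ 0#)

    private
      fibre-cong : ∀ (F : FibredFunction A) {r s} {m n : Elem A} →
                   r ≡ s → proj₁ m ≈ proj₁ n → (F [ r ]) m ≈ (F [ s ]) n
      fibre-cong F {r} refl e = Func.cong (F r) e

    fun-cong : ∀ F {m n : Elem A} → proj₁ m ≈ proj₁ n → fun F m ≈ fun F n
    fun-cong F e = tail-cong (fibre-cong F (%p-cong e) e)

    iterate-cong : ∀ F closed k {m n : Elem A} → proj₁ m ≈ proj₁ n →
      proj₁ (iterate (step F closed) m k) ≈ proj₁ (iterate (step F closed) n k)
    iterate-cong F closed zero    e = e
    iterate-cong F closed (suc k) {m} {n} e =
      iterate-cong F closed k (fun-cong F {m} {n} e)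

    digitTable : (F : FibredFunction A) → Closed F → DigitTable A
    digitTable F closed = record
      { table = record
        { to   = λ n k → proj₁ (iterate (step F closed) n k) %p
        ; cong = λ e k → %p-cong (iterate-cong F closed k e)
        }
      ; head = λ n → refl
      }

  full-closed : (F : FibredFunction full) → Closed F
  full-closed F n = tt

  IsPAdicSystem : FibredFunction full → Set
  IsPAdicSystem F = BlockProperty (digitTable F (full-closed F))

{-# OPTIONS --safe #-}
-- By the block property, sending a residue n mod pᵏ to the first k entries
-- of D[n] is an injection of ℤ/pᵏℤ into the pᵏ words of length k, hence a
-- bijection. Passing to the limit, every digit sequence is the row of exactly
-- one element of ℤₚ. Let σ(n) be the element whose row is D[n] with its first
-- entry dropped. A function has digit table D iff it equals σ, and canonical
-- form then forces F[r](n) = p·σ(n) for n ≡ r (mod p) and F[r](n) = 0 otherwise.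
module Submission where

open import Defs
open import Algebra.Bundles using (CommutativeRing)
open import Data.Fin.Base using (Fin; toℕ; fromℕ<; punchOut; funToFin; finToFun)
open import Data.Fin.Properties as Fin
  using (toℕ<n; toℕ-fromℕ<; toℕ-injective; finToFun-funToFin)
open import Data.Integer.Base as Int using (+_; 0ℤ)
open import Data.Integer.DivMod using (_/ℕ_; _%ℕ_; n%ℕd<d; a≡a%ℕn+[a/ℕn]*n)
open import Data.Integer.Divisibility.Signed
  using (divides; ∣-trans; ∣ᵤ⇒∣; *-cancelˡ-∣)
  renaming (_∣_ to _∣ᶻ_)
import Data.Integer.Properties as Int
open import Algebra.Properties.Ring Int.+-*-ring using (x[y-z]≈xy-xz)
open import Data.Nat.Base as ℕ
  using (ℕ; zero; suc; _^_; _<_; _≤_; _≤′_; ≤′-refl; ≤′-step; NonZero; NonTrivial)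
import Data.Nat.Divisibility as ℕ
import Data.Nat.DivMod as ℕ
open import Data.Nat.GeneralisedArithmetic using (iterate)
import Data.Nat.Properties as ℕ
open import Data.Product.Base using (Σ-syntax; ∃; _×_; _,_; proj₁; proj₂)
open import Data.Unit.Base using (tt)
open import Function.Base using (_∘_)
open import Function.Bundles using (Func; Equivalence; mk⇔)
open import Function.Definitions using (Injective)
open import Relation.Binary.PropositionalEquality
  using (_≡_; _≢_; refl; sym; trans; cong; subst; subst₂; module ≡-Reasoning)
open import Relation.Nullary.Decidable using (Dec; yes; no)
open import Relation.Nullary.Negation using (contradiction)

-- Finite sets and words.

-- Pigeonhole: if `y` were missed, deleting it from the codomain with `punchOut` would inject
-- `suc n` elements into `n`.
injective⇒surjective : ∀ {n} (f : Fin n → Fin n) → Injective _≡_ _≡_ f →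
                       ∀ y → ∃ λ x → f x ≡ y
injective⇒surjective {suc n} f inj y with Fin.any? (λ x → f x Fin.≟ y)
... | yes hit = hit
... | no miss = contradiction
  (Fin.injective⇒≤ {f = λ x → punchOut (y≢f x)}
    (λ {i} {j} e → inj (Fin.punchOut-injective (y≢f i) (y≢f j) e)))
  ℕ.1+n≰n
  where y≢f : ∀ x → y ≢ f x
        y≢f x e = miss (x , sym e)

funToFin-injective : ∀ {m n} {f g : Fin m → Fin n} → funToFin f ≡ funToFin g →
                     ∀ i → f i ≡ g i
funToFin-injective {f = f} {g} e i = trans (sym (finToFun-funToFin f i))
  (trans (cong (λ w → finToFun w i) e) (finToFun-funToFin g i))

0%ℕd≡0 : ∀ d .{{_ : NonZero d}} → 0ℤ %ℕ d ≡ 0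
0%ℕd≡0 (suc d) = refl

d∣a⇒a%ℕd≡0 : ∀ a d .{{_ : NonZero d}} → + d ∣ᶻ a → a %ℕ d ≡ 0
d∣a⇒a%ℕd≡0 a d d∣a = trans
  (Mod.rem-cong a 0ℤ d (subst (+ d ∣ᶻ_) (sym (Int.+-identityʳ a)) d∣a))
  (0%ℕd≡0 d)

d∣a⇒[a/ℕd]*d≡a : ∀ a d .{{_ : NonZero d}} → + d ∣ᶻ a → (a /ℕ d) Int.* + d ≡ a
d∣a⇒[a/ℕd]*d≡a a d d∣a = sym (begin
  a                                   ≡⟨ a≡a%ℕn+[a/ℕn]*n a d ⟩
  + (a %ℕ d) Int.+ (a /ℕ d) Int.* + d ≡⟨ cong (λ r → + r Int.+ (a /ℕ d) Int.* + d) (d∣a⇒a%ℕd≡0 a d d∣a) ⟩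
  0ℤ Int.+ (a /ℕ d) Int.* + d         ≡⟨ Int.+-identityˡ _ ⟩
  (a /ℕ d) Int.* + d                  ∎)
  where open ≡-Reasoning

module _ (p : ℕ) .{{_ : NonTrivial p}} where
  open PAdic p
  private
    instance
      p≢0 : NonZero p
      p≢0 = ℕ.nonTrivial⇒nonZero p

    module R = CommutativeRing ℤₚ-ring

  -- Divisibility and cancellation in ℤₚ through components.

  ^-monoʳ-∣ : ∀ {j k} → j ≤ k → p ^ j ℕ.∣ p ^ k
  ^-monoʳ-∣ {j} {k} j≤k = ℕ.divides (p ^ (k ℕ.∸ j))
    (trans (cong (p ^_) (sym (ℕ.m∸n+n≡m j≤k))) (ℕ.^-distribˡ-+-* p (k ℕ.∸ j) j))

  coherent-≤ : ∀ x {j k} → j ≤ k → + (p ^ j) ∣ᶻ res x k Int.- res x j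
  coherent-≤ x {j} j≤k = go (ℕ.≤⇒≤′ j≤k)
    where
    go : ∀ {k} → j ≤′ k → + (p ^ j) ∣ᶻ res x k Int.- res x j
    go ≤′-refl = Mod.≡⇒∣ {a = res x j} refl
    go (≤′-step {k} j≤′k) = Mod.∣-transᵈ {a = res x (suc k)} {b = res x k}
      (∣-trans (∣ᵤ⇒∣ (^-monoʳ-∣ (ℕ.≤′⇒≤ j≤′k))) (coherent x k)) (go j≤′k)

  -- Component `k` knows `x` only modulo `p ^ k`, so a divisor `d` survives the passage to it when
  -- `d` divides `p ^ k`.
  ∣⇒∣res : ∀ {d} x k → d ℕ.∣ p ^ k → ι (+ d) ∣ x → + d ∣ᶻ res x k
  ∣⇒∣res {d} x k d∣p^k (q Div., q*d≈x) =
    Mod.∣-diff {b = res q k Int.* + d} (divides (res q k) refl)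
      (Mod.∣-sym {a = res q k Int.* + d} (∣-trans (∣ᵤ⇒∣ d∣p^k) (at q*d≈x k)))

  ∣res⇒∣ : ∀ x k → + (p ^ k) ∣ᶻ res x k → ι (+ (p ^ k)) ∣ x
  ∣res⇒∣ x k p^k∣xₖ = quotient Div., mk≈ λ j →
    subst (λ a → + (p ^ j) ∣ᶻ a Int.- res x j)
          (sym (d∣a⇒[a/ℕd]*d≡a (res x (j ℕ.+ k)) (p ^ k) (p^k∣ j)))
          (coherent-≤ x (ℕ.m≤m+n j k))
    where
    instance
      p^k≢0 : NonZero (p ^ k)
      p^k≢0 = ℕ.m^n≢0 p k
    quotient : ℤₚ
    quotient = record
      -- Dividing by `p ^ k` costs `k` levels of precision, so the quotient modulo `p ^ j` comes
      -- from `x` modulo `p ^ (j + k)`.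
      { res      = λ j → res x (j ℕ.+ k) /ℕ (p ^ k)
      ; coherent = λ j → Mod./-cong (res x (suc j ℕ.+ k)) (res x (j ℕ.+ k)) (p ^ k) (p ^ j)
          (subst (λ d → + d ∣ᶻ res x (suc j ℕ.+ k) Int.- res x (j ℕ.+ k))
                 (trans (ℕ.^-distribˡ-+-* p j k) (ℕ.*-comm (p ^ j) (p ^ k)))
                 (coherent x (j ℕ.+ k)))
      }
    p^k∣ : ∀ j → + (p ^ k) ∣ᶻ res x (j ℕ.+ k)
    p^k∣ j = Mod.∣-diff {b = res x k} p^k∣xₖ (coherent-≤ x (ℕ.m≤n+m k j))

  toℕ-%p : ∀ x → toℕ (x %p) ≡ res x 1 %ℕ p
  toℕ-%p x = toℕ-fromℕ< (n%ℕd<d (res x 1) p)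

  p∣p^1 : p ℕ.∣ p ^ 1
  p∣p^1 = ℕ.∣-reflexive (sym (ℕ.^-identityʳ p))

  p∣x⇒x%p≡0 : ∀ {x} → ι (+ p) ∣ x → toℕ (x %p) ≡ 0
  p∣x⇒x%p≡0 {x} p∣x =
    trans (toℕ-%p x) (d∣a⇒a%ℕd≡0 (res x 1) p (∣⇒∣res x 1 p∣p^1 p∣x))

  ≋⇒%p≡ : ∀ {x r} → x ≋ ⌊ r ⌋ [mod p ] → x %p ≡ r
  ≋⇒%p≡ {x} {r} x≋r = toℕ-injective (begin
    toℕ (x %p)       ≡⟨ toℕ-%p x ⟩
    res x 1 %ℕ p     ≡⟨ Mod.rem-cong (res x 1) (+ toℕ r) p (∣⇒∣res (x - ⌊ r ⌋) 1 p∣p^1 x≋r) ⟩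
    toℕ r ℕ.% p      ≡⟨ ℕ.m<n⇒m%n≡m (toℕ<n r) ⟩
    toℕ r            ∎)
    where open ≡-Reasoning

  %p≡⇒≋ : ∀ {x r} → x %p ≡ r → x ≋ ⌊ r ⌋ [mod p ]
  %p≡⇒≋ {x} refl = x≋x%p x

  -- Even for composite `p`, `p` itself is not a zero divisor. Cancelling it costs one level:
  -- compare at `suc k`, then descend to `k` by coherence.
  p*-cancel : ∀ {x y} → ι (+ p) * x ≈ ι (+ p) * y → x ≈ y
  p*-cancel {x} {y} e = mk≈ λ k →
    Mod.∣-transᵈ {a = res x k} {b = res x (suc k)}
      (Mod.∣-sym {a = res x (suc k)} (coherent x k))
      (Mod.∣-transᵈ {a = res x (suc k)} {b = res y (suc k)} (shifted k) (coherent y k))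
    where
    instance
      +p≢0 : Int.NonZero (+ p)
      +p≢0 = p≢0
    shifted : ∀ k → + (p ^ k) ∣ᶻ res x (suc k) Int.- res y (suc k)
    shifted k = *-cancelˡ-∣ (+ p) (subst₂ _∣ᶻ_ (Int.pos-* p (p ^ k))
      (sym (x[y-z]≈xy-xz (+ p) (res x (suc k)) (res y (suc k)))) (at e (suc k)))

  -- The leading digit of `y` is 0, so subtracting it changes nothing and the division is exact.
  p∣y⇒p*tail≈y : ∀ {y} → ι (+ p) ∣ y → ι (+ p) * ((y - ⌊ y %p ⌋) /p) ≈ y
  p∣y⇒p*tail≈y {y} p∣y =
    ≈-trans (R.*-congˡ {ι (+ p)} (/p-cong y-0≈y)) (p∣x⇒p*[x/p]≈x y p∣y)
    where
    y-0≈y : y - ⌊ y %p ⌋ ≈ y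
    y-0≈y = mk≈ λ k → Mod.≡⇒∣ {a = res (y - ⌊ y %p ⌋) k}
      (trans (cong (λ r → res y k Int.- + r) (p∣x⇒x%p≡0 p∣y)) (Int.+-identityʳ _))

  -- In canonical form `fun F` loses no information about the active fibre. Both existence and
  -- uniqueness rest on this.
  p*fun≈ : ∀ {F : FibredFunction full} → CanonicalForm F → ∀ n →
           ι (+ p) * fun F n ≈ (F [ proj₁ n %p ]) n
  p*fun≈ canonical n@(x , _) =
    p∣y⇒p*tail≈y (proj₁ (canonical (x %p) n) (x≋x%p x))

  -- Digit sequences and the elements realising them.

  module _ (D : DigitTable full) (block : BlockProperty D) where

    digit : ℤₚ → ℕ → Fin p
    digit x = row D (x , tt)

    agree⇒∣res : ∀ k x y → (∀ i → i < k → digit x i ≡ digit y i) →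
                 + (p ^ k) ∣ᶻ res x k Int.- res y k
    agree⇒∣res k x y agree = ∣⇒∣res (x - y) k ℕ.∣-refl
      (Equivalence.from (block k (x , tt) (y , tt)) agree)

    ∣res⇒agree : ∀ k x y → + (p ^ k) ∣ᶻ res x k Int.- res y k →
                 ∀ i → i < k → digit x i ≡ digit y i
    ∣res⇒agree k x y h =
      Equivalence.to (block k (x , tt) (y , tt)) (∣res⇒∣ (x - y) k h)

    digit-cong : ∀ {x y} → x ≈ y → ∀ i → digit x i ≡ digit y i
    digit-cong e = Func.cong (DigitTable.table D) e

    digit-injective : ∀ {x y} → (∀ i → digit x i ≡ digit y i) → x ≈ y
    digit-injective {x} {y} e = mk≈ λ k → agree⇒∣res k x y λ i _ → e i

    prefix : ∀ k → Fin (p ^ k) → Fin k → Fin p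
    prefix k a j = digit (ι (+ toℕ a)) (toℕ j)

    prefix≗⇒agree : ∀ k a (s : ℕ → Fin p) → (∀ j → prefix k a j ≡ s (toℕ j)) →
                    ∀ i → i < k → digit (ι (+ toℕ a)) i ≡ s i
    prefix≗⇒agree k a s e i i<k =
      subst (λ i → digit (ι (+ toℕ a)) i ≡ s i) (toℕ-fromℕ< i<k) (e (fromℕ< i<k))

    -- Equal words force congruence modulo `p ^ k` by the block property, and congruent numbers
    -- below `p ^ k` are equal. Coding words by `funToFin` gives a self-map of `Fin (p ^ k)`, ready
    -- for the pigeonhole argument.
    prefix-injective : ∀ k → Injective _≡_ _≡_ (funToFin ∘ prefix k)
    prefix-injective k {a} {b} e = toℕ-injective (begin
      toℕ a               ≡⟨ ℕ.m<n⇒m%n≡m (toℕ<n a) ⟨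
      toℕ a ℕ.% (p ^ k)   ≡⟨ Mod.rem-cong (+ toℕ a) (+ toℕ b) (p ^ k) a≡b ⟩
      toℕ b ℕ.% (p ^ k)   ≡⟨ ℕ.m<n⇒m%n≡m (toℕ<n b) ⟩
      toℕ b               ∎)
      where
      open ≡-Reasoning
      instance
        p^k≢0 : NonZero (p ^ k)
        p^k≢0 = ℕ.m^n≢0 p k
      a≡b : + (p ^ k) ∣ᶻ + toℕ a Int.- + toℕ b
      a≡b = agree⇒∣res k (ι (+ toℕ a)) (ι (+ toℕ b))
        (prefix≗⇒agree k a (digit (ι (+ toℕ b))) (funToFin-injective e))

    approximate : ∀ (s : ℕ → Fin p) k →
      Σ[ a ∈ Fin (p ^ k) ] (∀ i → i < k → digit (ι (+ toℕ a)) i ≡ s i)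
    approximate s k
      with a , e ← injective⇒surjective (funToFin ∘ prefix k) (prefix-injective k)
                                        (funToFin {k} (s ∘ toℕ))
      = a , prefix≗⇒agree k a s (funToFin-injective e)

    -- Approximations of lengths `k` and `suc k` share their first `k` digits, so the block property
    -- makes them congruent modulo `p ^ k`; this is the coherence of the limit.
    realise : ∀ (s : ℕ → Fin p) → Σ[ x ∈ ℤₚ ] (∀ i → digit x i ≡ s i)
    realise s = x , λ i → trans
      -- The limit and its approximation have the same component at `suc i`, hence agree through
      -- entry `i`; level `i` would stop one short.
      (∣res⇒agree (suc i) x (xₖ (suc i)) (Mod.≡⇒∣ {a = res x (suc i)} refl) i ℕ.≤-refl)
      (xₖ-digit (suc i) i ℕ.≤-refl)
      where
      xₖ : ℕ → ℤₚ
      xₖ k = ι (+ toℕ (proj₁ (approximate s k)))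
      xₖ-digit : ∀ k i → i < k → digit (xₖ k) i ≡ s i
      xₖ-digit k = proj₂ (approximate s k)
      x : ℤₚ
      x = record
        { res      = λ k → res (xₖ k) k
        ; coherent = λ k → agree⇒∣res k (xₖ (suc k)) (xₖ k) λ i i<k →
            trans (xₖ-digit (suc k) i (ℕ.m<n⇒m<1+n i<k)) (sym (xₖ-digit k i i<k))
        }

    -- The shift and the function built from it.

    σ : ℤₚ → ℤₚ
    σ x = proj₁ (realise (digit x ∘ suc))

    digit-σ : ∀ x i → digit (σ x) i ≡ digit x (suc i)
    digit-σ x = proj₂ (realise (digit x ∘ suc))

    -- An element is determined by its row, so it does not matter which representative `realise`
    -- finds.
    σ-cong : ∀ {x y} → x ≈ y → σ x ≈ σ y
    σ-cong {x} {y} e = digit-injective λ i →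
      trans (digit-σ x i) (trans (digit-cong e (suc i)) (sym (digit-σ y i)))

    -- The decision is an argument so that `fibre-cong` can match on those for `x` and `y`
    -- separately.
    fibre : ∀ {r} x → Dec (x %p ≡ r) → ℤₚ
    fibre x (yes _) = ι (+ p) * σ x
    fibre x (no  _) = 0#

    fibre-cong : ∀ {r x y} (x? : Dec (x %p ≡ r)) (y? : Dec (y %p ≡ r)) →
                 x ≈ y → fibre x x? ≈ fibre y y?
    fibre-cong (yes _) (yes _) e = R.*-congˡ {ι (+ p)} (σ-cong e)
    fibre-cong (no  _) (no  _) e = ≈-refl {0#}
    fibre-cong (yes u) (no ¬v) e = contradiction (trans (sym (%p-cong e)) u) ¬v
    fibre-cong (no ¬u) (yes v) e = contradiction (trans (%p-cong e) v) ¬u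

    F : FibredFunction full
    F r = record
      { to   = λ n → fibre (proj₁ n) (proj₁ n %p Fin.≟ r)
      ; cong = λ {m} {n} → fibre-cong (proj₁ m %p Fin.≟ r) (proj₁ n %p Fin.≟ r)
      }

    fibre-≡ : ∀ {r x} (x? : Dec (x %p ≡ r)) → x %p ≡ r → fibre x x? ≈ ι (+ p) * σ x
    fibre-≡ {x = x} (yes _) _ = ≈-refl {ι (+ p) * σ x}
    fibre-≡ (no ¬u) u = contradiction u ¬u

    F-canonical : CanonicalForm F
    F-canonical r (x , _) with x %p Fin.≟ r
    ... | yes u = (λ _ → σ x Div., R.*-comm (σ x) (ι (+ p)))
                , (λ x≇r → contradiction (%p≡⇒≋ {x} u) x≇r)
    ... | no _ = (λ _ → ι (+ p) Div.∣0) , (λ _ → ≈-refl {0#})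

    fun-F≈σ : ∀ n → fun F n ≈ σ (proj₁ n)
    fun-F≈σ n@(x , _) = p*-cancel
      -- The test `x %p Fin.≟ x %p` does not reduce for a variable `x`, so `fibre-≡` selects the
      -- branch.
      (≈-trans (p*fun≈ {F} F-canonical n) (fibre-≡ (x %p Fin.≟ x %p) refl))

    -- Each application of `fun F` acts as `σ` and drops one digit. Since `iterate` steps its
    -- starting point first, the induction hypothesis is taken at `step F closed n`.
    digit-iterate : ∀ closed k n i →
      digit (proj₁ (iterate (step F closed) n k)) i ≡ digit (proj₁ n) (k ℕ.+ i)
    digit-iterate closed zero    n i = refl
    digit-iterate closed (suc k) n i = begin
      digit (proj₁ (iterate (step F closed) (step F closed n) k)) i
        ≡⟨ digit-iterate closed k (step F closed n) i ⟩
      digit (fun F n) (k ℕ.+ i)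
        ≡⟨ digit-cong (fun-F≈σ n) (k ℕ.+ i) ⟩
      digit (σ (proj₁ n)) (k ℕ.+ i)
        ≡⟨ digit-σ (proj₁ n) (k ℕ.+ i) ⟩
      digit (proj₁ n) (suc k ℕ.+ i) ∎
      where open ≡-Reasoning

    digitTable-F≈D : digitTable F (full-closed F) ≈ᵀ D
    digitTable-F≈D n k = begin
      -- The head condition of `D` turns the residue of the iterate into entry 0 of its row, where
      -- the shift formula applies.
      proj₁ nₖ %p               ≡⟨ DigitTable.head D nₖ ⟨
      digit (proj₁ nₖ) 0        ≡⟨ digit-iterate (full-closed F) k n 0 ⟩
      digit (proj₁ n) (k ℕ.+ 0) ≡⟨ cong (digit (proj₁ n)) (ℕ.+-identityʳ k) ⟩
      digit (proj₁ n) k         ∎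
      where
      open ≡-Reasoning
      nₖ : Elem full
      nₖ = iterate (step F (full-closed F)) n k

    -- Uniqueness and the block property of the new table.

    fun≈σ : ∀ (G : FibredFunction full) closed → digitTable G closed ≈ᵀ D →
            ∀ n → fun G n ≈ σ (proj₁ n)
    fun≈σ G closed G≈D n = digit-injective λ i → begin
      digit (fun G n) i                         ≡⟨ G≈D (step G closed n) i ⟨
      -- Holds by unfolding `iterate`: entry `i` of the table of `G` at `fun G n` is entry `suc i`
      -- at `n`.
      row (digitTable G closed) n (suc i)       ≡⟨ G≈D n (suc i) ⟩
      digit (proj₁ n) (suc i)                   ≡⟨ digit-σ (proj₁ n) i ⟨
      digit (σ (proj₁ n)) i                     ∎
      where open ≡-Reasoning

    -- On the class of `r`, `p*fun≈` recovers the fibre of `G` from `fun G`, which `fun≈σ`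
    -- identifies with `σ`; off that class canonical form forces zero.
    F-unique : ∀ (G : FibredFunction full) → CanonicalForm G →
               (closed : Closed G) → digitTable G closed ≈ᵀ D → G ≈ᶠ F
    F-unique G canonical closed G≈D r n@(x , _) with x %p Fin.≟ r
    ... | yes refl = ≈-trans (≈-sym (p*fun≈ {G} canonical n))
                             (R.*-congˡ {ι (+ p)} (fun≈σ G closed G≈D n))
    ... | no x≢r = proj₂ (canonical r n) (x≢r ∘ ≋⇒%p≡ {x})

    F-isPAdicSystem : IsPAdicSystem F
    F-isPAdicSystem k m n = mk⇔
      (λ m≋n i i<k → trans (digitTable-F≈D m i)
        (trans (Equivalence.to (block k m n) m≋n i i<k) (sym (digitTable-F≈D n i))))
      (λ agree → Equivalence.from (block k m n) λ i i<k →
        trans (sym (digitTable-F≈D m i)) (trans (agree i i<k) (digitTable-F≈D n i)))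

theorem3p12 : (p : ℕ) .{{_ : NonTrivial p}} →
    let open PAdic p in
    (D : DigitTable full) → BlockProperty D →
    Σ[ F ∈ FibredFunction full ]
    ((CanonicalForm F × Σ[ closed ∈ Closed F ] (digitTable F closed ≈ᵀ D)) ×
    (∀ (G : FibredFunction full) → CanonicalForm G →
    (closed : Closed G) → digitTable G closed ≈ᵀ D → G ≈ᶠ F) ×
    IsPAdicSystem F)
theorem3p12 p D block =
  F p D block ,
  (F-canonical p D block , full-closed (F p D block) , digitTable-F≈D p D block) ,
  F-unique p D block ,
  F-isPAdicSystem p D block
  where open PAdic p using (full-closed)
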